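{- The formal power series $\mathcal{E}_1(x)=\sum_{n=1}^{\infty}e(n)x^n\in\mathbb{Z}[[x]]$ satisfies $$\mathcal{E}_1(x)=\mathcal{E}_1(x^2)+\frac{x^2+1}{x}\,\mathcal{E}_1(x^4)+\frac{x^2}{1-x}.$$
   Context: The Stern polynomials $B_n(t)\in\mathbb{Z}[t]$ are defined by $B_0(t)=0$, $B_1(t)=1$, and for $n\geq 1$: $B_{2n}(t)=tB_n(t)$, $B_{2n+1}(t)=B_n(t)+B_{n+1}(t)$. For $n\geq1$ let $e(n)=\deg B_n(t)$. -}

module Defs where

open import Data.Bool.Base using (if_then_else_)
open import Data.Fin.Base using (toℕ)
open import Data.Integer.Base as ℤ using (ℤ; +_; 0ℤ; 1ℤ)
import Data.Integer.Properties as ℤₚ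
open import Data.List.Base using (List; []; _∷_)
open import Data.List.Relation.Unary.All using (All; []; _∷_; all?)
open import Data.Nat.Base as ℕ using (ℕ; zero; suc; _∸_; _<_; s≤s; ⌊_/2⌋; ⌈_/2⌉; parity)
open import Data.Nat.Divisibility using (_∣?_; quotient)
open import Data.Nat.Induction using (<-wellFounded)
import Data.Nat.Properties as ℕₚ
open import Data.Parity.Base using (Parity; 0ℙ; 1ℙ)
open import Data.Product.Base using (∃; _×_; _,_)
open import Data.Sum.Base using ([_,_]′)
open import Function.Base using (_∘_)
open import Induction.WellFounded using (Acc; acc)
open import Relation.Binary.PropositionalEquality using (_≡_; _≢_; refl; sym; trans; cong; cong₂; module ≡-Reasoning)
open import Relation.Nullary using (¬_; Dec; yes; no; does; contradiction)

open import Algebra.Properties.Monoid.Sum ℤₚ.+-0-monoid using (sum⁺-syntax)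

-- Coefficient lists, constant term first; trailing zeros are allowed.
Poly : Set
Poly = List ℤ

coeff : Poly → ℕ → ℤ
coeff []      _       = 0ℤ
coeff (a ∷ _) zero    = a
coeff (_ ∷ p) (suc n) = coeff p n

infixl 6 _+ᴾ_

_+ᴾ_ : Poly → Poly → Poly
[]      +ᴾ q       = q
(a ∷ p) +ᴾ []      = a ∷ p
(a ∷ p) +ᴾ (b ∷ q) = (a ℤ.+ b) ∷ (p +ᴾ q)

t·_ : Poly → Poly
t· p = 0ℤ ∷ p

IsZero : Poly → Set
IsZero = All (_≡ 0ℤ)

isZero? : (p : Poly) → Dec (IsZero p)
isZero? = all? (ℤₚ._≟ 0ℤ)

-- The zero polynomial is given the junk value deg 0 = 0; see deg-spec for
-- the other polynomials.
deg : Poly → ℕ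
deg []      = 0
deg (_ ∷ p) = if does (isZero? p) then 0 else suc (deg p)

coeff-zero : ∀ {p} → IsZero p → ∀ j → coeff p j ≡ 0ℤ
coeff-zero []       _       = refl
coeff-zero (z ∷ _)  zero    = z
coeff-zero (_ ∷ zs) (suc j) = coeff-zero zs j

deg-spec : ∀ p → ¬ IsZero p →
           coeff p (deg p) ≢ 0ℤ × (∀ j → deg p < j → coeff p j ≡ 0ℤ)
deg-spec []      p≢0 = contradiction [] p≢0
deg-spec (a ∷ p) p≢0 with isZero? p
... | yes p≡0 = (λ a≡0 → p≢0 (a≡0 ∷ p≡0)) , λ { (suc j) _ → coeff-zero p≡0 j }
... | no  p≢0′ with deg-spec p p≢0′
...   | lead , above = lead , λ { (suc j) (s≤s d<j) → above j d<j }

-- For n = 2m the index n + 2 is 2(m + 1), with ⌊n/2⌋ = m; for n = 2m + 1 it is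
-- 2(m + 1) + 1, with ⌊n/2⌋ = m and ⌈n/2⌉ = m + 1.
sternStep : Parity → Poly → Poly → Poly
sternStep 0ℙ p q = t· p
sternStep 1ℙ p q = p +ᴾ q

sternAcc : ∀ n → Acc _<_ n → Poly
sternAcc 0             _        = []
sternAcc 1             _        = 1ℤ ∷ []
sternAcc (suc (suc n)) (acc rs) = sternStep (parity n)
  (sternAcc (suc ⌊ n /2⌋) (rs (s≤s (s≤s (ℕₚ.⌊n/2⌋≤n n)))))
  (sternAcc (suc ⌈ n /2⌉) (rs (s≤s (s≤s (ℕₚ.⌈n/2⌉≤n n)))))

-- The defining recurrence is recovered in B-even and B-odd.
B : ℕ → Poly
B n = sternAcc n (<-wellFounded n)

sternAcc-irr : ∀ n (p q : Acc _<_ n) → sternAcc n p ≡ sternAcc n q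
sternAcc-irr 0             _        _        = refl
sternAcc-irr 1             _        _        = refl
sternAcc-irr (suc (suc n)) (acc rs) (acc ss) =
  cong₂ (sternStep (parity n)) (sternAcc-irr (suc ⌊ n /2⌋) _ _) (sternAcc-irr (suc ⌈ n /2⌉) _ _)

B-step : ∀ n → B (suc (suc n)) ≡ sternStep (parity n) (B (suc ⌊ n /2⌋)) (B (suc ⌈ n /2⌉))
B-step n = cong₂ (sternStep (parity n)) (sternAcc-irr (suc ⌊ n /2⌋) _ _) (sternAcc-irr (suc ⌈ n /2⌉) _ _)

double : ∀ n → 2 ℕ.* suc n ≡ suc (suc (2 ℕ.* n))
double n = ℕₚ.*-suc 2 n

parity-2* : ∀ n → parity (2 ℕ.* n) ≡ 0ℙ
parity-2* zero    = refl
parity-2* (suc n) = trans (cong parity (double n)) (parity-2* n)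

parity-1+2* : ∀ n → parity (suc (2 ℕ.* n)) ≡ 1ℙ
parity-1+2* zero    = refl
parity-1+2* (suc n) = trans (cong (parity ∘ suc) (double n)) (parity-1+2* n)

⌊2*n/2⌋ : ∀ n → ⌊ 2 ℕ.* n /2⌋ ≡ n
⌊2*n/2⌋ zero    = refl
⌊2*n/2⌋ (suc n) = trans (cong ⌊_/2⌋ (double n)) (cong suc (⌊2*n/2⌋ n))

⌊1+2*n/2⌋ : ∀ n → ⌊ suc (2 ℕ.* n) /2⌋ ≡ n
⌊1+2*n/2⌋ zero    = refl
⌊1+2*n/2⌋ (suc n) = trans (cong ⌈_/2⌉ (double n)) (cong suc (⌊1+2*n/2⌋ n))

B-even : ∀ n .{{_ : ℕ.NonZero n}} → B (2 ℕ.* n) ≡ t· B n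
B-even (suc n) = begin
  B (2 ℕ.* suc n)                     ≡⟨ cong B (double n) ⟩
  B (suc (suc (2 ℕ.* n)))             ≡⟨ B-step (2 ℕ.* n) ⟩
  sternStep (parity (2 ℕ.* n)) p q    ≡⟨ cong (λ π → sternStep π p q) (parity-2* n) ⟩
  t· B (suc ⌊ 2 ℕ.* n /2⌋)            ≡⟨ cong (λ m → t· B (suc m)) (⌊2*n/2⌋ n) ⟩
  t· B (suc n)                        ∎
  where
  open ≡-Reasoning
  p = B (suc ⌊ 2 ℕ.* n /2⌋)
  q = B (suc ⌈ 2 ℕ.* n /2⌉)

B-odd : ∀ n .{{_ : ℕ.NonZero n}} → B (suc (2 ℕ.* n)) ≡ B n +ᴾ B (suc n)
B-odd (suc n) = begin
  B (suc (2 ℕ.* suc n))                                      ≡⟨ cong (B ∘ suc) (double n) ⟩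
  B (suc (suc (suc (2 ℕ.* n))))                              ≡⟨ B-step (suc (2 ℕ.* n)) ⟩
  sternStep (parity (suc (2 ℕ.* n))) p q                     ≡⟨ cong (λ π → sternStep π p q) (parity-1+2* n) ⟩
  B (suc ⌊ suc (2 ℕ.* n) /2⌋) +ᴾ B (suc (suc ⌊ 2 ℕ.* n /2⌋)) ≡⟨ cong₂ (λ m m′ → B (suc m) +ᴾ B (suc (suc m′))) (⌊1+2*n/2⌋ n) (⌊2*n/2⌋ n) ⟩
  B (suc n) +ᴾ B (suc (suc n))                               ∎
  where
  open ≡-Reasoning
  p = B (suc ⌊ suc (2 ℕ.* n) /2⌋)
  q = B (suc ⌈ suc (2 ℕ.* n) /2⌉)

e : ℕ → ℕ
e n = deg (B n)

Series : Set
Series = ℕ → ℤ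

infix  4 _≈_
infixl 6 _+ˢ_ _-ˢ_
infixl 7 _*ˢ_
infix  9 X^_ _⟨X^_⟩

_≈_ : Series → Series → Set
f ≈ g = ∀ n → f n ≡ g n

_+ˢ_ _-ˢ_ _*ˢ_ : Series → Series → Series
(f +ˢ g) n = f n ℤ.+ g n
(f -ˢ g) n = f n ℤ.- g n
(f *ˢ g) n = ∑[ i ≤ n ] (f (toℕ i) ℤ.* g (n ∸ toℕ i))

X^_ : ℕ → Series
(X^ k) n = if n ℕ.≡ᵇ k then 1ℤ else 0ℤ

1ˢ X : Series
1ˢ = X^ 0
X  = X^ 1

-- The substitution f(x ^ k) = Σ fᵢ x ^ (i k).
_⟨X^_⟩ : Series → (k : ℕ) .{{_ : ℕ.NonZero k}} → Series
(f ⟨X^ k ⟩) n with k ∣? n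
... | yes k∣n = f (quotient k∣n)
... | no  _   = 0ℤ

record NonZeroˢ (f : Series) : Set where
  constructor nonZeroˢ
  field
    index   : ℕ
    nonzero : f index ≢ 0ℤ

*ˢ-snoc : ∀ f g n → (f *ˢ g) (suc n) ≡ (f *ˢ (g ∘ suc)) n ℤ.+ f (suc n) ℤ.* g 0
*ˢ-snoc f g zero    = begin
  a ℤ.+ (b ℤ.+ 0ℤ)   ≡⟨ cong (λ z → a ℤ.+ z) (ℤₚ.+-identityʳ b) ⟩
  a ℤ.+ b            ≡⟨ cong (ℤ._+ b) (sym (ℤₚ.+-identityʳ a)) ⟩
  a ℤ.+ 0ℤ ℤ.+ b     ∎
  where
  open ≡-Reasoning
  a = f 0 ℤ.* g 1
  b = f 1 ℤ.* g 0
*ˢ-snoc f g (suc n) = trans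
  (cong (λ z → f 0 ℤ.* g (suc (suc n)) ℤ.+ z) (*ˢ-snoc (f ∘ suc) g n))
  (sym (ℤₚ.+-assoc (f 0 ℤ.* g (suc (suc n))) _ _))

*ˢ-nonZero : ∀ {f g} → NonZeroˢ f → NonZeroˢ g → NonZeroˢ (f *ˢ g)
*ˢ-nonZero {f} {g} (nonZeroˢ k fk≢0) (nonZeroˢ l gl≢0) =
  let n , h = left f k fk≢0 in nonZeroˢ n h
  where
  right : ∀ f g → f 0 ≢ 0ℤ → ∀ l → g l ≢ 0ℤ → ∃ λ n → (f *ˢ g) n ≢ 0ℤ
  right f g f0≢0 l gl≢0 with g 0 ℤₚ.≟ 0ℤ
  right f g f0≢0 l       gl≢0 | no g0≢0 = 0 , λ eq →
    [ f0≢0 , g0≢0 ]′ (ℤₚ.i*j≡0⇒i≡0∨j≡0 (f 0) (trans (sym (ℤₚ.+-identityʳ _)) eq))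
  right f g f0≢0 zero    gl≢0 | yes g0≡0 = contradiction g0≡0 gl≢0
  right f g f0≢0 (suc l) gl≢0 | yes g0≡0 with right f (g ∘ suc) f0≢0 l gl≢0
  ... | n , h = suc n , λ eq → h (begin
    (f *ˢ (g ∘ suc)) n                         ≡⟨ sym (ℤₚ.+-identityʳ _) ⟩
    (f *ˢ (g ∘ suc)) n ℤ.+ 0ℤ                  ≡⟨ cong (λ z → (f *ˢ (g ∘ suc)) n ℤ.+ z) (sym (ℤₚ.*-zeroʳ (f (suc n)))) ⟩
    (f *ˢ (g ∘ suc)) n ℤ.+ f (suc n) ℤ.* 0ℤ    ≡⟨ cong (λ z → (f *ˢ (g ∘ suc)) n ℤ.+ f (suc n) ℤ.* z) (sym g0≡0) ⟩
    (f *ˢ (g ∘ suc)) n ℤ.+ f (suc n) ℤ.* g 0   ≡⟨ sym (*ˢ-snoc f g n) ⟩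
    (f *ˢ g) (suc n)                           ≡⟨ eq ⟩
    0ℤ                                         ∎)
    where open ≡-Reasoning

  left : ∀ f k → f k ≢ 0ℤ → ∃ λ n → (f *ˢ g) n ≢ 0ℤ
  left f k fk≢0 with f 0 ℤₚ.≟ 0ℤ
  left f k       fk≢0 | no f0≢0  = right f g f0≢0 l gl≢0
  left f zero    fk≢0 | yes f0≡0 = contradiction f0≡0 fk≢0
  left f (suc k) fk≢0 | yes f0≡0 with left (f ∘ suc) k fk≢0
  ... | n , h = suc n , λ eq → h (begin
    ((f ∘ suc) *ˢ g) n                               ≡⟨ sym (ℤₚ.+-identityˡ _) ⟩
    0ℤ ℤ.* g (suc n) ℤ.+ ((f ∘ suc) *ˢ g) n          ≡⟨ cong (λ z → z ℤ.* g (suc n) ℤ.+ ((f ∘ suc) *ˢ g) n) (sym f0≡0) ⟩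
    (f *ˢ g) (suc n)                                 ≡⟨ eq ⟩
    0ℤ                                               ∎)
    where open ≡-Reasoning

instance
  1ˢ-nonZero : NonZeroˢ 1ˢ
  1ˢ-nonZero = nonZeroˢ 0 λ ()

  X-nonZero : NonZeroˢ X
  X-nonZero = nonZeroˢ 1 λ ()

  1-X-nonZero : NonZeroˢ (1ˢ -ˢ X)
  1-X-nonZero = nonZeroˢ 0 λ ()

-- The field of fractions of ℤ[[x]]. It contains ℤ((x)), in which the right-hand
-- side of the functional equation lives because of the factor x⁻¹.
infix 8 _/ᶠ_

record Frac : Set where
  constructor _/ᶠ_
  field
    num       : Series
    den       : Series
    {{den≢0}} : NonZeroˢ den

infix  4 _≃_
infixl 6 _+ᶠ_
infixl 7 _*ᶠ_

_≃_ : Frac → Frac → Set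
(f /ᶠ g) ≃ (f′ /ᶠ g′) = f *ˢ g′ ≈ f′ *ˢ g

_+ᶠ_ _*ᶠ_ : Frac → Frac → Frac
_+ᶠ_ (_/ᶠ_ f g {{p}}) (_/ᶠ_ f′ g′ {{p′}}) = _/ᶠ_ (f *ˢ g′ +ˢ f′ *ˢ g) (g *ˢ g′) {{*ˢ-nonZero p p′}}
_*ᶠ_ (_/ᶠ_ f g {{p}}) (_/ᶠ_ f′ g′ {{p′}}) = _/ᶠ_ (f *ˢ f′) (g *ˢ g′) {{*ˢ-nonZero p p′}}

⌜_⌝ : Series → Frac
⌜ f ⌝ = f /ᶠ 1ˢ

-- Σ_{n ≥ 1} e(n) xⁿ; e 0 is never used.
E₁ : Series
E₁ 0         = 0ℤ
E₁ n@(suc _) = + e n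

{-# OPTIONS --safe #-}

-- The coefficients of Bₙ are non-negative, so no cancellation occurs in
-- B₂ₙ₊₁ = Bₙ + Bₙ₊₁ and e(2n) = e(n) + 1, e(2n+1) = max(e(n), e(n+1)). By
-- induction consecutive values of e differ by at most 1, whence
-- e(4n+1) = e(n) + 1 and e(4n+3) = e(n+1) + 1. Multiplied by x(1 - x), the
-- functional equation compares coefficients according to the index modulo 4.
module Submission where

open import Data.Fin.Base using (zero; suc)
open import Data.Integer.Base as ℤ using (+_; 0ℤ; 1ℤ; +≤+)
import Data.Integer.Properties as ℤₚ
import Data.Integer.Tactic.RingSolver as ℤ-Solver
open import Data.List.Base using ([]; _∷_)
open import Data.List.Relation.Unary.All using (All; []; _∷_)
open import Data.Nat.Base using (ℕ; zero; suc; _+_; _*_; _⊔_; _≤_; _<_; z≤n; s≤s; NonZero; nonZero)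
open import Data.Nat.Divisibility using (_∣_; _∣?_; divides; n∣m*n; ∣m+n∣m⇒∣n; >⇒∤)
open import Data.Nat.DivMod using (_divMod_; result)
open import Data.Nat.Induction using (<-rec)
import Data.Nat.Properties as ℕₚ
import Data.Nat.Tactic.RingSolver as ℕ-Solver
open import Data.Product.Base using (_×_; _,_; proj₁; proj₂)
open import Function.Base using (_∘_)
open import Relation.Binary.PropositionalEquality using (_≡_; refl; sym; trans; cong; cong₂; subst; module ≡-Reasoning)
open import Relation.Nullary using (¬_; yes; no; contradiction)
open import Defs

open ≡-Reasoning

-- Degrees of polynomials with non-negative coefficients

NonNeg : Poly → Set
NonNeg = All (0ℤ ℤ.≤_)

+ᴾ-nonNeg : ∀ {p q} → NonNeg p → NonNeg q → NonNeg (p +ᴾ q)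
+ᴾ-nonNeg []       ys       = ys
+ᴾ-nonNeg (x ∷ xs) []       = x ∷ xs
+ᴾ-nonNeg (x ∷ xs) (y ∷ ys) = ℤₚ.+-mono-≤ x y ∷ +ᴾ-nonNeg xs ys

+ᴾ-isZero : ∀ {p q} → IsZero p → IsZero q → IsZero (p +ᴾ q)
+ᴾ-isZero []       ys       = ys
+ᴾ-isZero (x ∷ xs) []       = x ∷ xs
+ᴾ-isZero (x ∷ xs) (y ∷ ys) = cong₂ ℤ._+_ x y ∷ +ᴾ-isZero xs ys

i+j≡0⇒i≡0×j≡0 : ∀ {i j} → 0ℤ ℤ.≤ i → 0ℤ ℤ.≤ j → i ℤ.+ j ≡ 0ℤ → i ≡ 0ℤ × j ≡ 0ℤ
i+j≡0⇒i≡0×j≡0 {+ m} {+ n} (+≤+ _) (+≤+ _) eq =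
  cong +_ (ℕₚ.m+n≡0⇒m≡0 m m+n≡0) , cong +_ (ℕₚ.m+n≡0⇒n≡0 m m+n≡0)
  where m+n≡0 = ℤₚ.+-injective eq

-- Non-negative integers with sum zero are both zero; applied to each coefficient, this excludes
-- cancellation.
+ᴾ-isZero⁻ : ∀ {p q} → NonNeg p → NonNeg q → IsZero (p +ᴾ q) → IsZero p × IsZero q
+ᴾ-isZero⁻ []       ys       zs       = [] , zs
+ᴾ-isZero⁻ (x ∷ xs) []       zs       = zs , []
+ᴾ-isZero⁻ (x ∷ xs) (y ∷ ys) (z ∷ zs) =
  let a≡0 , b≡0 = i+j≡0⇒i≡0×j≡0 x y z
      p≡0 , q≡0 = +ᴾ-isZero⁻ xs ys zs
  in a≡0 ∷ p≡0 , b≡0 ∷ q≡0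

deg-isZero : ∀ {p} → IsZero p → deg p ≡ 0
deg-isZero []                   = refl
deg-isZero {_ ∷ p} (_ ∷ p≡0) with isZero? p
... | yes _  = refl
... | no p≢0 = contradiction p≡0 p≢0

deg-t· : ∀ p → ¬ IsZero p → deg (t· p) ≡ suc (deg p)
deg-t· p p≢0 with isZero? p
... | yes p≡0 = contradiction p≡0 p≢0
... | no _    = refl

-- `deg` tests whether the tail is zero, and by `+ᴾ-isZero⁻` the tail of the sum passes this test
-- exactly when both tails do.
deg-+ᴾ : ∀ {p q} → NonNeg p → NonNeg q → deg (p +ᴾ q) ≡ deg p ⊔ deg q
deg-+ᴾ []           ys     = refl
deg-+ᴾ {p} (_ ∷ _)  []     = sym (ℕₚ.⊔-identityʳ (deg p))
deg-+ᴾ {_ ∷ p} {_ ∷ q} (_ ∷ xs) (_ ∷ ys)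
  with isZero? p | isZero? q | isZero? (p +ᴾ q) | deg-+ᴾ xs ys
... | yes p≡0 | yes q≡0 | yes _   | _  = refl
... | yes p≡0 | yes q≡0 | no ≢0   | _  = contradiction (+ᴾ-isZero p≡0 q≡0) ≢0
... | no p≢0  | _       | yes ≡0  | _  = contradiction (proj₁ (+ᴾ-isZero⁻ xs ys ≡0)) p≢0
... | yes _   | no q≢0  | yes ≡0  | _  = contradiction (proj₂ (+ᴾ-isZero⁻ xs ys ≡0)) q≢0
-- The zero tail has the default degree 0, which is neutral for `_⊔_`.
... | yes p≡0 | no _    | no _    | ih = cong suc (trans ih (cong (_⊔ deg q) (deg-isZero p≡0)))
... | no _    | yes q≡0 | no _    | ih =
  cong suc (trans ih (trans (cong (deg p ⊔_) (deg-isZero q≡0)) (ℕₚ.⊔-identityʳ (deg p))))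
... | no _    | no _    | no _    | ih = cong suc ih

-- Recurrences for the degree sequence

-- Induction along the Stern recurrence: an index of at least 2 is 2m or 2m + 1 with m positive, and
-- the indices m and m + 1 that it calls on are smaller.
stern-rec : (P : ℕ → Set) → P 1 →
            (∀ n → P (suc n) → P (2 * suc n)) →
            (∀ n → P (suc n) → P (suc (suc n)) → P (suc (2 * suc n))) →
            ∀ n → P (suc n)
stern-rec P base even odd = <-rec (P ∘ suc) step
  where
  step : ∀ n → (∀ {m} → m < n → P (suc m)) → P (suc n)
  step zero    ih = base
  -- The index in question is n + 2, so the quotient q of n by 2 gives m = q + 1.
  step (suc n) ih with n divMod 2
  ... | result q zero refl =
    subst P (trans (double q) (cong (λ m → 2 + m) (ℕₚ.*-comm 2 q)))
      (even q (ih (s≤s (ℕₚ.m≤m*n q 2))))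
  ... | result q (suc zero) refl =
    subst P (cong suc (trans (double q) (cong (λ m → 2 + m) (ℕₚ.*-comm 2 q))))
      (odd q (ih (s≤s (ℕₚ.m≤n⇒m≤1+n (ℕₚ.m≤m*n q 2)))) (ih (s≤s (s≤s (ℕₚ.m≤m*n q 2)))))

-- The two properties are proved together: a sum of non-negative polynomials stays nonzero because
-- nothing cancels.
B-nonNeg-nonZero : ∀ n → NonNeg (B (suc n)) × ¬ IsZero (B (suc n))
B-nonNeg-nonZero = stern-rec (λ n → NonNeg (B n) × ¬ IsZero (B n))
  (+≤+ z≤n ∷ [] , λ { (() ∷ _) })
  (λ n (p≥0 , p≢0) → subst (λ p → NonNeg p × ¬ IsZero p) (sym (B-even (suc n)))
    (ℤₚ.≤-refl ∷ p≥0 , λ { (_ ∷ p≡0) → p≢0 p≡0 }))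
  (λ n (p≥0 , p≢0) (q≥0 , _) → subst (λ p → NonNeg p × ¬ IsZero p) (sym (B-odd (suc n)))
    (+ᴾ-nonNeg p≥0 q≥0 , p≢0 ∘ proj₁ ∘ +ᴾ-isZero⁻ p≥0 q≥0))

e-even : ∀ n → e (2 * suc n) ≡ suc (e (suc n))
e-even n = trans (cong deg (B-even (suc n))) (deg-t· (B (suc n)) (proj₂ (B-nonNeg-nonZero n)))

e-odd : ∀ n → e (suc (2 * suc n)) ≡ e (suc n) ⊔ e (suc (suc n))
e-odd n = trans (cong deg (B-odd (suc n)))
  (deg-+ᴾ (proj₁ (B-nonNeg-nonZero n)) (proj₁ (B-nonNeg-nonZero (suc n))))

e-even′ : ∀ n → e (suc (suc (2 * n))) ≡ suc (e (suc n))
e-even′ n = trans (cong e (sym (double n))) (e-even n)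

Close : ℕ → ℕ → Set
Close m n = m ≤ suc n × n ≤ suc m

-- With a = e(n) and b = e(n + 1), the values at 2n, 2n + 1, 2n + 2 are a + 1, max(a, b), b + 1;
-- neighbours among these differ by at most 1 if a and b do.
e-close : ∀ n → Close (e (suc n)) (e (suc (suc n)))
e-close = stern-rec (λ n → Close (e n) (e (suc n)))
  (z≤n , s≤s z≤n)
  (λ n (_ , b≤1+a) → close-resp (e-even n) (e-odd n)
    ( s≤s (ℕₚ.m≤m⊔n _ _)
    , ℕₚ.m≤n⇒m≤1+n (ℕₚ.⊔-lub (ℕₚ.n≤1+n _) b≤1+a)))
  (λ n (a≤1+b , _) _ → close-resp (e-odd n) (e-even′ (suc n))
    ( ℕₚ.m≤n⇒m≤1+n (ℕₚ.⊔-lub a≤1+b (ℕₚ.n≤1+n _))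
    , s≤s (ℕₚ.m≤n⊔m (e (suc n)) _)))
  where
  close-resp : ∀ {a b c d} → a ≡ c → b ≡ d → Close c d → Close a b
  close-resp refl refl cl = cl

-- With m = n + 1, 4m + 1 = 2(2m) + 1, and e(2m) = e(m) + 1 dominates e(2m + 1) = max(e(m), e(m +
-- 1)) by closeness. The index 1 is an exception, since e(1) = 0.
e-1+4* : ∀ n → e (1 + suc n * 4) ≡ suc (e (suc n))
e-1+4* n = begin
  e (1 + suc n * 4)                              ≡⟨ cong e (index n) ⟩
  e (suc (2 * suc (suc (2 * n))))                ≡⟨ e-odd (suc (2 * n)) ⟩
  e (2 + 2 * n) ⊔ e (3 + 2 * n)                  ≡⟨ cong₂ _⊔_ (e-even′ n) (cong (e ∘ suc) (sym (double n))) ⟩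
  suc (e (suc n)) ⊔ e (suc (2 * suc n))          ≡⟨ cong (suc (e (suc n)) ⊔_) (e-odd n) ⟩
  suc (e (suc n)) ⊔ (e (suc n) ⊔ e (suc (suc n))) ≡⟨ ℕₚ.m≥n⇒m⊔n≡m (ℕₚ.⊔-lub (ℕₚ.n≤1+n _) (proj₂ (e-close n))) ⟩
  suc (e (suc n))                                ∎
  where
  index : ∀ n → 1 + suc n * 4 ≡ suc (2 * suc (suc (2 * n)))
  index = ℕ-Solver.solve-∀

e-3+4* : ∀ n → e (3 + n * 4) ≡ suc (e (suc n))
-- Here 2n + 1 = 1, to which `e-odd` does not apply.
e-3+4* zero    = refl
e-3+4* (suc n) = begin
  e (3 + suc n * 4)                              ≡⟨ cong e (index n) ⟩
  e (suc (2 * suc (2 * suc n)))                  ≡⟨ e-odd (2 * suc n) ⟩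
  e (suc (2 * suc n)) ⊔ e (2 + 2 * suc n)        ≡⟨ cong₂ _⊔_ (e-odd n) (e-even′ (suc n)) ⟩
  (e (suc n) ⊔ e (2 + n)) ⊔ suc (e (2 + n))      ≡⟨ ℕₚ.m≤n⇒m⊔n≡n (ℕₚ.⊔-lub (proj₁ (e-close n)) (ℕₚ.n≤1+n _)) ⟩
  suc (e (suc (suc n)))                          ∎
  where
  index : ∀ n → 3 + suc n * 4 ≡ suc (2 * suc (2 * suc n))
  index = ℕ-Solver.solve-∀

-- Power series

-- Multiplication by x in a form that computes; `*ˢ-X` links it to the product.
shift : Series → Series
shift f zero    = 0ℤ
shift f (suc n) = f n

shift-cong : ∀ {f g} → f ≈ g → shift f ≈ shift g
shift-cong f≈g zero    = refl
shift-cong f≈g (suc n) = f≈g n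

shift-+ˢ : ∀ f g → shift (f +ˢ g) ≈ shift f +ˢ shift g
shift-+ˢ f g zero    = refl
shift-+ˢ f g (suc n) = refl

shift-X^ : ∀ k → shift (X^ k) ≈ X^ (suc k)
shift-X^ k zero    = refl
shift-X^ k (suc n) = refl

-- At `suc n` the product unfolds to `f 0 ℤ.* g (suc n)` plus the coefficient of `(f ∘ suc) *ˢ g` at
-- `n`, which allows recursion on the index with `f` replaced by its tail.
*ˢ-cong : ∀ {f f′ g g′} → f ≈ f′ → g ≈ g′ → f *ˢ g ≈ f′ *ˢ g′
*ˢ-cong f≈ g≈ zero    = cong₂ ℤ._+_ (cong₂ ℤ._*_ (f≈ 0) (g≈ 0)) refl
*ˢ-cong f≈ g≈ (suc n) =
  cong₂ ℤ._+_ (cong₂ ℤ._*_ (f≈ 0) (g≈ (suc n))) (*ˢ-cong (f≈ ∘ suc) g≈ n)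

*ˢ-distribˡ--ˢ : ∀ f g h → f *ˢ (g -ˢ h) ≈ f *ˢ g -ˢ f *ˢ h
*ˢ-distribˡ--ˢ f g h zero = ring (f 0) (g 0) (h 0)
  where
  ring : ∀ a b c → a ℤ.* (b ℤ.- c) ℤ.+ 0ℤ ≡ (a ℤ.* b ℤ.+ 0ℤ) ℤ.- (a ℤ.* c ℤ.+ 0ℤ)
  ring = ℤ-Solver.solve-∀
*ˢ-distribˡ--ˢ f g h (suc n) = trans
  (cong₂ ℤ._+_ (refl {x = f 0 ℤ.* (g (suc n) ℤ.- h (suc n))}) (*ˢ-distribˡ--ˢ (f ∘ suc) g h n))
  (ring (f 0) (g (suc n)) (h (suc n)) _ _)
  where
  ring : ∀ a b c x y → a ℤ.* (b ℤ.- c) ℤ.+ (x ℤ.- y) ≡ (a ℤ.* b ℤ.+ x) ℤ.- (a ℤ.* c ℤ.+ y)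
  ring = ℤ-Solver.solve-∀

*ˢ-distribʳ-+ˢ : ∀ f g h → (f +ˢ g) *ˢ h ≈ f *ˢ h +ˢ g *ˢ h
*ˢ-distribʳ-+ˢ f g h zero = ring (f 0) (g 0) (h 0)
  where
  ring : ∀ a b c → (a ℤ.+ b) ℤ.* c ℤ.+ 0ℤ ≡ (a ℤ.* c ℤ.+ 0ℤ) ℤ.+ (b ℤ.* c ℤ.+ 0ℤ)
  ring = ℤ-Solver.solve-∀
*ˢ-distribʳ-+ˢ f g h (suc n) = trans
  (cong₂ ℤ._+_ (refl {x = (f 0 ℤ.+ g 0) ℤ.* h (suc n)}) (*ˢ-distribʳ-+ˢ (f ∘ suc) (g ∘ suc) h n))
  (ring (f 0) (g 0) (h (suc n)) _ _)
  where
  ring : ∀ a b c x y → (a ℤ.+ b) ℤ.* c ℤ.+ (x ℤ.+ y) ≡ (a ℤ.* c ℤ.+ x) ℤ.+ (b ℤ.* c ℤ.+ y)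
  ring = ℤ-Solver.solve-∀

*ˢ-zeroˡ : ∀ f → (λ _ → 0ℤ) *ˢ f ≈ (λ _ → 0ℤ)
*ˢ-zeroˡ f zero    = refl
*ˢ-zeroˡ f (suc n) = trans (ℤₚ.+-identityˡ _) (*ˢ-zeroˡ f n)

*ˢ-zeroʳ : ∀ f → f *ˢ (λ _ → 0ℤ) ≈ (λ _ → 0ℤ)
*ˢ-zeroʳ f zero    = cong (ℤ._+ 0ℤ) (ℤₚ.*-zeroʳ (f 0))
*ˢ-zeroʳ f (suc n) = cong₂ ℤ._+_ (ℤₚ.*-zeroʳ (f 0)) (*ˢ-zeroʳ (f ∘ suc) n)

*ˢ-identityˡ : ∀ f → 1ˢ *ˢ f ≈ f
*ˢ-identityˡ f zero    = trans (ℤₚ.+-identityʳ _) (ℤₚ.*-identityˡ (f 0))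
*ˢ-identityˡ f (suc n) =
  trans (cong₂ ℤ._+_ (ℤₚ.*-identityˡ (f (suc n))) (*ˢ-zeroˡ f n)) (ℤₚ.+-identityʳ _)

*ˢ-identityʳ : ∀ f → f *ˢ 1ˢ ≈ f
*ˢ-identityʳ f zero    = trans (ℤₚ.+-identityʳ _) (ℤₚ.*-identityʳ (f 0))
*ˢ-identityʳ f (suc n) = trans (*ˢ-snoc f 1ˢ n)
  (trans (cong₂ ℤ._+_ (*ˢ-zeroʳ f n) (ℤₚ.*-identityʳ (f (suc n)))) (ℤₚ.+-identityˡ _))

X^suc-*ˢ : ∀ k f → X^ (suc k) *ˢ f ≈ shift (X^ k *ˢ f)
X^suc-*ˢ k f zero    = refl
X^suc-*ˢ k f (suc n) = ℤₚ.+-identityˡ _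

-- `*ˢ-snoc` splits off the last summand, which vanishes because `X^ (suc k)` has constant term
-- zero.
*ˢ-X^suc : ∀ f k → f *ˢ X^ (suc k) ≈ shift (f *ˢ X^ k)
*ˢ-X^suc f k zero    = cong (ℤ._+ 0ℤ) (ℤₚ.*-zeroʳ (f 0))
*ˢ-X^suc f k (suc n) = trans (*ˢ-snoc f (X^ (suc k)) n)
  (trans (cong₂ ℤ._+_ (refl {x = (f *ˢ X^ k) n}) (ℤₚ.*-zeroʳ (f (suc n)))) (ℤₚ.+-identityʳ ((f *ˢ X^ k) n)))

*ˢ-X : ∀ f → f *ˢ X ≈ shift f
*ˢ-X f n = trans (*ˢ-X^suc f 0 n) (shift-cong (*ˢ-identityʳ f) n)

*ˢ-1-X : ∀ f → f *ˢ (1ˢ -ˢ X) ≈ f -ˢ shift f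
*ˢ-1-X f n = trans (*ˢ-distribˡ--ˢ f 1ˢ X n) (cong₂ ℤ._-_ (*ˢ-identityʳ f n) (*ˢ-X f n))

X²-*ˢ : ∀ f → X^ 2 *ˢ f ≈ shift (shift f)
X²-*ˢ f n = trans (X^suc-*ˢ 1 f n)
  (shift-cong (λ m → trans (X^suc-*ˢ 0 f m) (shift-cong (*ˢ-identityˡ f) m)) n)

1*X*1 : 1ˢ *ˢ (X *ˢ 1ˢ) ≈ X
1*X*1 n = trans (*ˢ-identityˡ (X *ˢ 1ˢ) n) (*ˢ-identityʳ X n)

⟨X^⟩-multiple : ∀ f k .{{_ : NonZero k}} q → (f ⟨X^ k ⟩) (q * k) ≡ f q
⟨X^⟩-multiple f k q with k ∣? (q * k)
... | yes (divides r eq) = cong f (sym (ℕₚ.*-cancelʳ-≡ q r k eq))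
... | no  k∤qk           = contradiction (n∣m*n q) k∤qk

-- Otherwise `k` would divide `suc r`, which is positive and below `k`.
⟨X^⟩-remainder : ∀ f k .{{_ : NonZero k}} r q → suc r < k → (f ⟨X^ k ⟩) (suc r + q * k) ≡ 0ℤ
⟨X^⟩-remainder f k r q r<k with k ∣? (suc r + q * k)
... | yes k∣n = contradiction (∣m+n∣m⇒∣n (subst (k ∣_) (ℕₚ.+-comm (suc r) (q * k)) k∣n) (n∣m*n q)) (>⇒∤ r<k)
... | no  _   = refl

-- X ^ k / (1 - X)
geometric : ℕ → Series
geometric zero    _       = 1ℤ
geometric (suc k) zero    = 0ℤ
geometric (suc k) (suc n) = geometric k n

geometric-X^ : ∀ k → geometric k -ˢ shift (geometric k) ≈ X^ k
geometric-X^ zero    zero          = refl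
geometric-X^ zero    (suc n)       = refl
geometric-X^ (suc k) zero          = refl
geometric-X^ (suc k) (suc zero)    = geometric-X^ k zero
geometric-X^ (suc k) (suc (suc n)) = geometric-X^ k (suc n)

-- The functional equation

1<2 : 1 < 2
1<2 = s≤s (s≤s z≤n)

1<4 : 1 < 4
1<4 = s≤s (s≤s z≤n)

2<4 : 2 < 4
2<4 = s≤s (s≤s (s≤s z≤n))

3<4 : 3 < 4
3<4 = s≤s (s≤s (s≤s (s≤s z≤n)))

sum-cong : ∀ {a a′ b b′ c c′ d} → a ≡ a′ → b ≡ b′ → c ≡ c′ →
           a ℤ.+ (b ℤ.+ c) ℤ.+ d ≡ a′ ℤ.+ (b′ ℤ.+ c′) ℤ.+ d
sum-cong refl refl refl = refl

-- The right-hand side is the form to which the integer sums with vanishing summands below compute.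
suc≡+0+1 : ∀ m → suc m ≡ m + 0 + 1
suc≡+0+1 = ℕ-Solver.solve-∀

-- The summands on the right are the coefficients of E₁(x²), x E₁(x⁴), x⁻¹ E₁(x⁴) and x²/(1 - x). In
-- each residue class modulo 4 at most one of the first three is nonzero, and the last supplies the
-- increment 1 once n is at least 2.
E₁-coefficient : ∀ n → E₁ n ≡
  (E₁ ⟨X^ 2 ⟩) n ℤ.+ (shift (E₁ ⟨X^ 4 ⟩) n ℤ.+ (E₁ ⟨X^ 4 ⟩) (suc n)) ℤ.+ geometric 2 n
E₁-coefficient n with n divMod 4
... | result zero zero refl = refl
... | result (suc q) zero refl = begin
  + e (suc q * 4)                           ≡⟨ cong (+_ ∘ e) (index₂ q) ⟩
  + e (2 * (2 + 2 * q))                     ≡⟨ cong +_ (e-even (suc (2 * q))) ⟩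
  + suc (e (2 + 2 * q))                     ≡⟨ cong +_ (suc≡+0+1 _) ⟩
  E₁ (2 + 2 * q) ℤ.+ (0ℤ ℤ.+ 0ℤ) ℤ.+ 1ℤ     ≡⟨ sym (sum-cong
    (trans (cong (E₁ ⟨X^ 2 ⟩) (index₁ q)) (⟨X^⟩-multiple E₁ 2 (2 + 2 * q)))
    (⟨X^⟩-remainder E₁ 4 2 q 3<4) (⟨X^⟩-remainder E₁ 4 0 (suc q) 1<4)) ⟩
  _                                         ∎
  where
  index₁ : ∀ q → suc q * 4 ≡ (2 + 2 * q) * 2
  index₁ = ℕ-Solver.solve-∀
  index₂ : ∀ q → suc q * 4 ≡ 2 * (2 + 2 * q)
  index₂ = ℕ-Solver.solve-∀
-- At n = 1 both sides vanish: x E₁(x⁴) contributes `E₁ 0`, set to zero, and `geometric 2` starts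
-- only at index 2.
... | result zero (suc zero) refl = refl
... | result (suc q) (suc zero) refl = begin
  + e (1 + suc q * 4)                       ≡⟨ cong +_ (e-1+4* q) ⟩
  + suc (e (suc q))                         ≡⟨ cong +_ (suc≡+0+1 _) ⟩
  0ℤ ℤ.+ (E₁ (suc q) ℤ.+ 0ℤ) ℤ.+ 1ℤ         ≡⟨ sym (sum-cong
    (trans (cong (E₁ ⟨X^ 2 ⟩) (index q)) (⟨X^⟩-remainder E₁ 2 0 (2 + 2 * q) 1<2))
    (⟨X^⟩-multiple E₁ 4 (suc q)) (⟨X^⟩-remainder E₁ 4 1 (suc q) 2<4)) ⟩
  _                                         ∎
  where
  index : ∀ q → 1 + suc q * 4 ≡ 1 + (2 + 2 * q) * 2
  index = ℕ-Solver.solve-∀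
... | result q (suc (suc zero)) refl = begin
  + e (2 + q * 4)                           ≡⟨ cong (+_ ∘ e) (index₂ q) ⟩
  + e (2 * suc (2 * q))                     ≡⟨ cong +_ (e-even (2 * q)) ⟩
  + suc (e (suc (2 * q)))                   ≡⟨ cong +_ (suc≡+0+1 _) ⟩
  E₁ (suc (2 * q)) ℤ.+ (0ℤ ℤ.+ 0ℤ) ℤ.+ 1ℤ   ≡⟨ sym (sum-cong
    (trans (cong (E₁ ⟨X^ 2 ⟩) (index₁ q)) (⟨X^⟩-multiple E₁ 2 (suc (2 * q))))
    (⟨X^⟩-remainder E₁ 4 0 q 1<4) (⟨X^⟩-remainder E₁ 4 2 q 3<4)) ⟩
  _                                         ∎
  where
  index₁ : ∀ q → 2 + q * 4 ≡ suc (2 * q) * 2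
  index₁ = ℕ-Solver.solve-∀
  index₂ : ∀ q → 2 + q * 4 ≡ 2 * suc (2 * q)
  index₂ = ℕ-Solver.solve-∀
... | result q (suc (suc (suc zero))) refl = begin
  + e (3 + q * 4)                           ≡⟨ cong +_ (e-3+4* q) ⟩
  + suc (e (suc q))                         ≡⟨ cong +_ (ℕₚ.+-comm 1 _) ⟩
  0ℤ ℤ.+ (0ℤ ℤ.+ E₁ (suc q)) ℤ.+ 1ℤ         ≡⟨ sym (sum-cong
    (trans (cong (E₁ ⟨X^ 2 ⟩) (index q)) (⟨X^⟩-remainder E₁ 2 0 (suc (2 * q)) 1<2))
    (⟨X^⟩-remainder E₁ 4 1 q 2<4) (⟨X^⟩-multiple E₁ 4 (suc q))) ⟩
  _                                         ∎
  where
  index : ∀ q → 3 + q * 4 ≡ 1 + suc (2 * q) * 2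
  index = ℕ-Solver.solve-∀

-- x F(x) for F(x) = E₁(x²) + (x² + 1) x⁻¹ E₁(x⁴); unlike F itself it is visibly in ℤ[[x]].
xF : Series
xF = shift (E₁ ⟨X^ 2 ⟩) +ˢ (shift (shift (E₁ ⟨X^ 4 ⟩)) +ˢ E₁ ⟨X^ 4 ⟩)

-- At index 0 the only candidate term is the constant term of E₁(x⁴), which is `E₁ 0`; the later
-- indices are `E₁-coefficient` moved up by one.
shift-E₁ : shift E₁ ≈ xF +ˢ geometric 3
shift-E₁ zero    = refl
shift-E₁ (suc n) = E₁-coefficient n

-- This unreduced product is the denominator that `_+ᶠ_` and `_*ᶠ_` build for the right-hand side of
-- the functional equation.
denominator : 1ˢ *ˢ (X *ˢ 1ˢ) *ˢ (1ˢ -ˢ X) ≈ X -ˢ X^ 2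
denominator n = begin
  (1ˢ *ˢ (X *ˢ 1ˢ) *ˢ (1ˢ -ˢ X)) n ≡⟨ *ˢ-1-X (1ˢ *ˢ (X *ˢ 1ˢ)) n ⟩
  ((1ˢ *ˢ (X *ˢ 1ˢ)) -ˢ shift (1ˢ *ˢ (X *ˢ 1ˢ))) n
    ≡⟨ cong₂ ℤ._-_ (1*X*1 n) (trans (shift-cong 1*X*1 n) (shift-X^ 1 n)) ⟩
  (X -ˢ X^ 2) n ∎

mainTheorem17 : ⌜ E₁ ⌝ ≃ ⌜ E₁ ⟨X^ 2 ⟩ ⌝ +ᶠ (X^ 2 +ˢ 1ˢ) /ᶠ X *ᶠ ⌜ E₁ ⟨X^ 4 ⟩ ⌝ +ᶠ X^ 2 /ᶠ (1ˢ -ˢ X)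
mainTheorem17 n = begin
  (E₁ *ˢ (1ˢ *ˢ (X *ˢ 1ˢ) *ˢ (1ˢ -ˢ X))) n
    ≡⟨ *ˢ-cong {E₁} (λ _ → refl) denominator n ⟩
  (E₁ *ˢ (X -ˢ X^ 2)) n
    ≡⟨ *ˢ-distribˡ--ˢ E₁ X (X^ 2) n ⟩
  (E₁ *ˢ X) n ℤ.- (E₁ *ˢ X^ 2) n
    ≡⟨ cong₂ ℤ._-_ (*ˢ-X E₁ n) (trans (*ˢ-X^suc E₁ 1 n) (shift-cong (*ˢ-X E₁) n)) ⟩
  -- The expression is the coefficient of (1 - x) x E₁(x), so the identity for x E₁(x) is
  -- substituted twice, once shifted.
  shift E₁ n ℤ.- shift (shift E₁) n
    ≡⟨ cong₂ ℤ._-_ (shift-E₁ n) (trans (shift-cong shift-E₁ n) (shift-+ˢ xF (geometric 3) n)) ⟩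
  (xF n ℤ.+ geometric 3 n) ℤ.- (shift xF n ℤ.+ shift (geometric 3) n)
    ≡⟨ rearrange (xF n) (geometric 3 n) (shift xF n) (shift (geometric 3) n) ⟩
  (xF n ℤ.- shift xF n) ℤ.+ (geometric 3 n ℤ.- shift (geometric 3) n)
    ≡⟨ cong₂ ℤ._+_ (sym (*ˢ-1-X xF n)) (geometric-X^ 3 n) ⟩
  (xF *ˢ (1ˢ -ˢ X)) n ℤ.+ (X^ 3) n
    ≡⟨ cong₂ ℤ._+_ (*ˢ-cong {g = 1ˢ -ˢ X} (sym ∘ numerator) (λ _ → refl) n) (sym (X²*X n)) ⟩
  (P *ˢ (1ˢ -ˢ X)) n ℤ.+ (X^ 2 *ˢ (1ˢ *ˢ (X *ˢ 1ˢ))) n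
    -- The final factor `1ˢ` is the denominator of `⌜ E₁ ⌝`, brought in by cross-multiplication.
    ≡⟨ sym (*ˢ-identityʳ (P *ˢ (1ˢ -ˢ X) +ˢ X^ 2 *ˢ (1ˢ *ˢ (X *ˢ 1ˢ))) n) ⟩
  ((P *ˢ (1ˢ -ˢ X) +ˢ X^ 2 *ˢ (1ˢ *ˢ (X *ˢ 1ˢ))) *ˢ 1ˢ) n ∎
  where
  -- The numerator of the sum of the first two fractions, over the denominator `1ˢ *ˢ (X *ˢ 1ˢ)`.
  P : Series
  P = E₁ ⟨X^ 2 ⟩ *ˢ (X *ˢ 1ˢ) +ˢ (X^ 2 +ˢ 1ˢ) *ˢ E₁ ⟨X^ 4 ⟩ *ˢ 1ˢ

  numerator : P ≈ xF
  numerator m = cong₂ ℤ._+_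
    (trans (*ˢ-cong {E₁ ⟨X^ 2 ⟩} (λ _ → refl) (*ˢ-identityʳ X) m) (*ˢ-X (E₁ ⟨X^ 2 ⟩) m))
    (begin
      ((X^ 2 +ˢ 1ˢ) *ˢ E₁ ⟨X^ 4 ⟩ *ˢ 1ˢ) m
        ≡⟨ *ˢ-identityʳ ((X^ 2 +ˢ 1ˢ) *ˢ E₁ ⟨X^ 4 ⟩) m ⟩
      ((X^ 2 +ˢ 1ˢ) *ˢ E₁ ⟨X^ 4 ⟩) m
        ≡⟨ *ˢ-distribʳ-+ˢ (X^ 2) 1ˢ (E₁ ⟨X^ 4 ⟩) m ⟩
      (X^ 2 *ˢ E₁ ⟨X^ 4 ⟩) m ℤ.+ (1ˢ *ˢ E₁ ⟨X^ 4 ⟩) m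
        ≡⟨ cong₂ ℤ._+_ (X²-*ˢ (E₁ ⟨X^ 4 ⟩) m) (*ˢ-identityˡ (E₁ ⟨X^ 4 ⟩) m) ⟩
      (shift (shift (E₁ ⟨X^ 4 ⟩)) +ˢ E₁ ⟨X^ 4 ⟩) m ∎)

  X²*X : X^ 2 *ˢ (1ˢ *ˢ (X *ˢ 1ˢ)) ≈ X^ 3
  X²*X m = trans (*ˢ-cong {X^ 2} (λ _ → refl) 1*X*1 m) (trans (*ˢ-X (X^ 2) m) (shift-X^ 2 m))

  rearrange : ∀ a b c d → (a ℤ.+ b) ℤ.- (c ℤ.+ d) ≡ (a ℤ.- c) ℤ.+ (b ℤ.- d)
  rearrange = ℤ-Solver.solve-∀
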